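{- Let $q\ge2$, and let $t,n$ be positive integers with $t\ge3$ and $2\le n<\frac{15+\sqrt{33}}{24}(t-1)^2$. Then $m_q(n,t)\le n$.
   Context: Let $Q=\{0,1,\dots,q-1\}$. For a nonempty set $X=\{\mathbf c^1,\dots,\mathbf c^s\}\subseteq Q^n$, a position $i\in[n]$ is undetectable for $X$ if $c^1_i=\dots=c^s_i$; let $U(X)$ be the set of undetectable positions and $\mathrm{wdesc}(X)=\{\mathbf y\in Q^n: y_i=c^1_i \text{ for all } i\in U(X)\}$. For $t\ge2$, a code $\mathcal C\subseteq Q^n$ is a wide-sense $t$-frameproof code if $\mathrm{wdesc}(X)\cap\mathcal C=X$ for every nonempty $X\subseteq\mathcal C$ with $|X|\le t$. $m_q(n,t)$ is the maximum size of a wide-sense $t$-frameproof code in $Q^n$. -}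

module Defs where

open import Data.Nat using (ℕ; _+_; _*_; _∸_; _^_; _≤_; _<_)
open import Data.Fin using (Fin)
open import Data.Vec using (Vec; lookup)
open import Data.List using (List; []; length)
open import Data.List.Membership.Propositional using (_∈_)
open import Data.List.Relation.Binary.Subset.Propositional using (_⊆_)
open import Data.List.Relation.Unary.Unique.Propositional using (Unique)
open import Data.Product using (_×_)
open import Data.Sum using (_⊎_)
open import Relation.Binary.PropositionalEquality using (_≡_; _≢_)

Word : ℕ → ℕ → Set
Word q n = Vec (Fin q) n

Undetectable : ∀ {q n} → List (Word q n) → Fin n → Set
Undetectable X i = ∀ c d → c ∈ X → d ∈ X → lookup c i ≡ lookup d i

InWdesc : ∀ {q n} → Word q n → List (Word q n) → Set
InWdesc {n = n} y X = ∀ (i : Fin n) → Undetectable X i → ∀ c → c ∈ X → lookup y i ≡ lookup c i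

-- A code is a duplicate-free list of words (a finite subset of Q^n).
-- Wide-sense t-frameproof: for every nonempty X ⊆ C with |X| ≤ t, wdesc(X) ∩ C = X.
-- (X ⊆ wdesc(X) ∩ C always holds, so only the inclusion wdesc(X) ∩ C ⊆ X is required.)
WideSenseFrameproof : ∀ {q n} → ℕ → List (Word q n) → Set
WideSenseFrameproof {q} {n} t C =
  ∀ (X : List (Word q n)) → X ≢ [] → Unique X → length X ≤ t → X ⊆ C →
  ∀ (y : Word q n) → y ∈ C → InWdesc y X → y ∈ X

-- n < (15 + √33)/24 · s, where s = (t-1)^2, expressed in ℕ:
-- 24n < 15s + √33 s  ⇔  24n ≤ 15s  or  (15s < 24n and (24n - 15s)^2 < 33 s^2)
BelowBound : ℕ → ℕ → Set
BelowBound n t = (24 * n ≤ 15 * s) ⊎ ((15 * s < 24 * n) × ((24 * n ∸ 15 * s) ^ 2 < 33 * s ^ 2))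
  where s = (t ∸ 1) ^ 2

{-# OPTIONS --safe #-}

-- Fix a codeword c₀. Frameproofness says that the difference sets {i : cᵢ ≠ c₀ᵢ} of the other
-- codewords form a (t - 1)-cover-free family, so a code of size n + 1 gives n sets on n points.
-- Deleting points that lie on a single set, together with that set, one may assume that there
-- are none. Put d = t - 1. If some set is heavy (size at least c (2d - 1) with
-- c = (15 + √33) / 24), remove it together with its points: what remains is (d - 1)-cover-free,
-- with more sets than points, and induction on d applies. If all sets are light, consider in each
-- set F the pairs that lie in no other set. The remaining pairs of F have no large matching, as it
-- would give a cover of F by d others, so by the Erdős–Gallai theorem F owns many pairs, and
-- double counting pairs of points gives n ≥ c d².
module Submission where

open import Defs
open import Data.Bool using (if_then_else_)
open import Data.Empty using (⊥)
open import Data.Fin using (Fin)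
open import Data.Fin.Properties as Fin using ()
open import Data.List using (List; []; _∷_; _++_; map; length; filter; cartesianProduct; allFin; deduplicate)
open import Data.List.Membership.Propositional using (_∈_; _∉_; find; lose)
open import Data.List.Membership.Propositional.Properties using (∈-length; ∈-∃++; ∈-++⁺ˡ; ∈-filter⁺; ∈-filter⁻; ∈-cartesianProduct⁺; ∈-cartesianProduct⁻; ∈-allFin; ∈-deduplicate⁺; ∈-deduplicate⁻)
open import Data.List.Properties using (map-++; length-++; length-tabulate; length-deduplicate)
open import Data.List.Relation.Binary.Permutation.Propositional using (_↭_; ↭-refl; ↭-prep; ↭-swap; ↭-trans; ↭-sym; ↭⇒↭ₛ; module PermutationReasoning)
open import Data.List.Relation.Binary.Permutation.Propositional.Properties using (shift; ++⁺ˡ; ++⁺ʳ; ↭-length; ∈-resp-↭; All-resp-↭) renaming (map⁺ to ↭-map⁺)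
import Data.List.Relation.Binary.Permutation.Setoid.Properties as PermutationSetoid
open import Data.List.Relation.Binary.Subset.Propositional using (_⊆_)
open import Data.List.Relation.Unary.All as All using (All; []; _∷_; all?)
open import Data.List.Relation.Unary.All.Properties using (All¬⇒¬Any; ¬Any⇒All¬; ¬All⇒Any¬)
open import Data.List.Relation.Unary.AllPairs using ([]; _∷_)
open import Data.List.Relation.Unary.Any using (Any; here; there; any?)
open import Data.List.Relation.Unary.Unique.DecPropositional.Properties using (deduplicate-!)
open import Data.List.Relation.Unary.Unique.Propositional using (Unique)
open import Data.List.Relation.Unary.Unique.Propositional.Properties using (allFin⁺) renaming (filter⁺ to Unique-filter⁺)
open import Data.Nat
open import Data.Nat.ListAction using (sum)
open import Data.Nat.ListAction.Properties using (sum-++; sum-↭)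
open import Data.Nat.Properties
open import Data.List.Extrema ≤-totalOrder using (argmin-all; f[argmin]≤f[⊤]; f[argmin]≤f[xs])
open import Data.Nat.Tactic.RingSolver using (solve-∀)
open import Data.Product using (∃; ∃₂; _×_; _,_; proj₁; proj₂; uncurry)
open import Data.Sum as Sum using (_⊎_; inj₁; inj₂)
open import Data.Vec using (lookup)
open import Data.Vec.Properties using (≡-dec)
open import Function using (_∘_; const; case_of_)
open import Level using (0ℓ)
open import Relation.Binary using (Rel; Decidable; Symmetric; Irreflexive; DecidableEquality)
open import Relation.Binary.PropositionalEquality using (_≡_; _≢_; refl; sym; trans; cong; cong₂; subst; setoid; module ≡-Reasoning)
open import Relation.Nullary using (¬_; Dec; yes; no; does; contradiction)
open import Relation.Nullary.Decidable using (¬?; _×-dec_; _⊎-dec_; decidable-stable)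

private variable
  A B : Set
  X Y : Set

-- Finite sums, indicators and duplicate-free lists

∑ : List A → (A → ℕ) → ℕ
∑ xs f = sum (map f xs)

∑-mono : ∀ (xs : List A) {f g} → (∀ {x} → x ∈ xs → f x ≤ g x) → ∑ xs f ≤ ∑ xs g
∑-mono []       _   = z≤n
∑-mono (x ∷ xs) f≤g = +-mono-≤ (f≤g (here refl)) (∑-mono xs (f≤g ∘ there))

∑-mono-< : ∀ {xs : List A} {f g z} → (∀ {x} → x ∈ xs → f x ≤ g x) →
           z ∈ xs → f z < g z → ∑ xs f < ∑ xs g
∑-mono-< {xs = x ∷ xs} f≤g (here refl) fz<gz = +-mono-<-≤ fz<gz (∑-mono xs (f≤g ∘ there))
∑-mono-< {xs = x ∷ xs} f≤g (there z∈xs) fz<gz =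
  +-mono-≤-< (f≤g (here refl)) (∑-mono-< (f≤g ∘ there) z∈xs fz<gz)

∑-+ : ∀ (xs : List A) f g → ∑ xs (λ x → f x + g x) ≡ ∑ xs f + ∑ xs g
∑-+ []       f g = refl
∑-+ (x ∷ xs) f g rewrite ∑-+ xs f g = interchange (f x) (g x) (∑ xs f) (∑ xs g)
  where
  interchange : ∀ a b c d → a + b + (c + d) ≡ a + c + (b + d)
  interchange = solve-∀

∑-*ʳ : ∀ (xs : List A) f k → ∑ xs (λ x → f x * k) ≡ ∑ xs f * k
∑-*ʳ []       f k = refl
∑-*ʳ (x ∷ xs) f k rewrite ∑-*ʳ xs f k = sym (*-distribʳ-+ k (f x) (∑ xs f))

∑-const : ∀ (xs : List A) k → ∑ xs (const k) ≡ length xs * k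
∑-const []       k = refl
∑-const (x ∷ xs) k = cong (k +_) (∑-const xs k)

∑-swap : ∀ (xs : List A) (ys : List B) (f : A → B → ℕ) →
         ∑ xs (λ x → ∑ ys (f x)) ≡ ∑ ys (λ y → ∑ xs (λ x → f x y))
∑-swap []       ys f = sym (trans (∑-const ys 0) (*-zeroʳ (length ys)))
∑-swap (x ∷ xs) ys f rewrite ∑-swap xs ys f = sym (∑-+ ys (f x) _)

∑-++ : ∀ (xs ys : List A) f → ∑ (xs ++ ys) f ≡ ∑ xs f + ∑ ys f
∑-++ xs ys f = trans (cong sum (map-++ f xs ys)) (sum-++ (map f xs) (map f ys))

∑-↭ : ∀ {xs ys : List A} f → xs ↭ ys → ∑ xs f ≡ ∑ ys f
∑-↭ f xs↭ys = sum-↭ (↭-map⁺ f xs↭ys)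

∑-filter-≤ : ∀ {P : A → Set} (P? : ∀ x → Dec (P x)) xs {f g} →
             (∀ x → f x ≤ g x) → ∑ (filter P? xs) f ≤ ∑ xs g
∑-filter-≤ P? []       f≤g = z≤n
∑-filter-≤ P? (x ∷ xs) f≤g with P? x
... | yes _ = +-mono-≤ (f≤g x) (∑-filter-≤ P? xs f≤g)
... | no  _ = ≤-trans (∑-filter-≤ P? xs f≤g) (m≤n+m _ _)

𝟙 : Dec X → ℕ
𝟙 X? = if does X? then 1 else 0

𝟙-mono : (X? : Dec X) (Y? : Dec Y) → (X → Y) → 𝟙 X? ≤ 𝟙 Y?
𝟙-mono (no _)  _       _ = z≤n
𝟙-mono (yes _) (yes _) _ = ≤-refl
𝟙-mono (yes x) (no ¬y) f = contradiction (f x) ¬y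

𝟙-yes : (X? : Dec X) → X → 1 ≤ 𝟙 X?
𝟙-yes (yes _) _ = ≤-refl
𝟙-yes (no ¬x) x = contradiction x ¬x

𝟙≤1 : (X? : Dec X) → 𝟙 X? ≤ 1
𝟙≤1 (yes _) = ≤-refl
𝟙≤1 (no _)  = z≤n

𝟙-no : (X? : Dec X) → ¬ X → 𝟙 X? ≡ 0
𝟙-no (yes x) ¬x = contradiction x ¬x
𝟙-no (no _)  _  = refl

count-≤1 : ∀ {xs : List A} {P : A → Set} (P? : ∀ x → Dec (P x)) → Unique xs →
           (∀ {x y} → x ∈ xs → y ∈ xs → P x → P y → x ≡ y) → ∑ xs (𝟙 ∘ P?) ≤ 1
count-≤1 P? [] _ = z≤n
count-≤1 {xs = x ∷ xs} P? (x∉xs ∷ xs!) uniq with P? x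
... | no _   = count-≤1 P? xs! λ y∈ z∈ → uniq (there y∈) (there z∈)
... | yes px = s≤s (≤-trans
  (∑-mono xs λ {y} y∈ → ≤-reflexive (𝟙-no (P? y) λ py →
    All.lookup x∉xs y∈ (uniq (here refl) (there y∈) px py)))
  (≤-reflexive (trans (∑-const xs 0) (*-zeroʳ (length xs)))))

∈⇒↭ : ∀ {x : A} {xs} → x ∈ xs → ∃ λ ys → xs ↭ x ∷ ys
∈⇒↭ {x = x} x∈xs with ys , zs , refl ← ∈-∃++ x∈xs = ys ++ zs , shift x ys zs

Unique-resp-↭ : ∀ {xs ys : List A} → xs ↭ ys → Unique xs → Unique ys
Unique-resp-↭ p = PermutationSetoid.Unique-resp-↭ (setoid _) (↭⇒↭ₛ p)

Unique-⊆⇒length-≤ : ∀ {xs ys : List A} → Unique xs → xs ⊆ ys → length xs ≤ length ys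
Unique-⊆⇒length-≤ [] _ = z≤n
Unique-⊆⇒length-≤ {xs = x ∷ xs} {ys} (x∉xs ∷ xs!) xs⊆ys
  with zs , ys↭x∷zs ← ∈⇒↭ (xs⊆ys (here refl)) =
  subst (suc (length xs) ≤_) (sym (↭-length ys↭x∷zs))
    (s≤s (Unique-⊆⇒length-≤ xs! xs⊆zs))
  where
  xs⊆zs : xs ⊆ zs
  xs⊆zs y∈xs with ∈-resp-↭ ys↭x∷zs (xs⊆ys (there y∈xs))
  ... | here refl  = contradiction refl (All.lookup x∉xs y∈xs)
  ... | there y∈zs = y∈zs

-- Matchings

flatten : List (A × A) → List A
flatten []            = []
flatten ((x , y) ∷ M) = x ∷ y ∷ flatten M

length-flatten : ∀ (M : List (A × A)) → length (flatten M) ≡ length M * 2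
length-flatten []      = refl
length-flatten (_ ∷ M) = cong (suc ∘ suc) (length-flatten M)

∈⇒↭-flatten : ∀ {x y : A} {M} → (x , y) ∈ M →
              ∃ λ M′ → M ↭ (x , y) ∷ M′ × flatten M ↭ x ∷ y ∷ flatten M′
∈⇒↭-flatten (here {xs = M} refl) = M , ↭-refl , ↭-refl
∈⇒↭-flatten {x = x} {y} (there {x = m@(u , v)} xy∈M)
  with M′ , p , q ← ∈⇒↭-flatten xy∈M =
  m ∷ M′ , ↭-trans (↭-prep m p) (↭-swap m _ ↭-refl) , (begin
    u ∷ v ∷ _                      ↭⟨ ↭-prep u (↭-prep v q) ⟩
    u ∷ v ∷ x ∷ y ∷ flatten M′     ↭⟨ shift x (u ∷ v ∷ []) _ ⟩
    x ∷ u ∷ v ∷ y ∷ flatten M′     ↭⟨ ↭-prep x (shift y (u ∷ v ∷ []) _) ⟩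
    x ∷ y ∷ u ∷ v ∷ flatten M′     ∎)
  where open PermutationReasoning

-- Vertex bookkeeping for enlarging a matching by the edge `x z`, with `z` taken from the uncovered
-- vertices and `y` left uncovered.
↭-extend : ∀ {x y z : A} (F : List A) {R R′} → R ↭ z ∷ R′ →
           x ∷ z ∷ F ++ y ∷ R′ ↭ x ∷ y ∷ F ++ R
↭-extend {x = x} {y} {z} F {R} {R′} R↭ = ↭-prep x (begin
  z ∷ F ++ y ∷ R′    ↭⟨ shift y (z ∷ F) R′ ⟩
  y ∷ z ∷ F ++ R′    ↭⟨ ↭-prep y (shift z F R′) ⟨
  y ∷ F ++ z ∷ R′    ↭⟨ ↭-prep y (++⁺ˡ F R↭) ⟨
  y ∷ F ++ R         ∎)
  where open PermutationReasoning

-- Vertex bookkeeping for trading the edge `u v` for the two edges `x u` and `y v`.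
↭-cross : ∀ {x y u v : A} {F F′ R} → F ↭ u ∷ v ∷ F′ →
          x ∷ u ∷ y ∷ v ∷ F′ ++ R ↭ x ∷ y ∷ F ++ R
↭-cross {x = x} {y} {u} {v} {R = R} F↭ =
  ↭-prep x (↭-trans (↭-swap u y ↭-refl) (↭-prep y (++⁺ʳ R (↭-sym F↭))))

∑-flatten-≥ : ∀ (M : List (A × A)) {f : A → ℕ} {k} →
              (∀ {x y} → (x , y) ∈ M → k ≤ f x + f y) → length M * k ≤ ∑ (flatten M) f
∑-flatten-≥ [] _ = z≤n
∑-flatten-≥ ((x , y) ∷ M) {f} k≤ =
  ≤-trans (+-mono-≤ (k≤ (here refl)) (∑-flatten-≥ M (k≤ ∘ there)))
          (≤-reflexive (+-assoc (f x) (f y) _))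

-- A matching of size s on the vertex list V in the complement of N,
-- given together with the list R of uncovered vertices.
CoMatching : Rel A 0ℓ → List A → ℕ → Set
CoMatching N V s = ∃₂ λ M R →
  length M ≡ s × flatten M ++ R ↭ V × All (λ (x , y) → ¬ N x y) M

complete-coMatching : ∀ {N : Rel A 0ℓ} s (V : List A) → 2 * s ≤ length V →
                      (∀ {x y} → x ∈ V → y ∈ V → ¬ N x y) → CoMatching N V s
complete-coMatching zero V _ _ = [] , V , refl , ↭-refl , []
complete-coMatching (suc s) V 2s≤ ¬N with subst (_≤ length V) (*-suc 2 s) 2s≤
complete-coMatching (suc s) (x ∷ y ∷ V) _ ¬N | s≤s (s≤s 2s≤)
  with M , R , eq , p , ¬NM ← complete-coMatching s V 2s≤
         (λ x∈ y∈ → ¬N (there (there x∈)) (there (there y∈))) =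
  (x , y) ∷ M , R , cong suc eq , ↭-prep x (↭-prep y p) , ¬N (here refl) (there (here refl)) ∷ ¬NM

-- A finite simple graph is described by its non-adjacency relation N.
record NonAdjacency (A : Set) : Set₁ where
  field
    N        : Rel A 0ℓ
    N?       : Decidable N
    N-sym    : Symmetric N
    N-irrefl : Irreflexive _≡_ N

-- Degree sums of non-adjacent pairs

module Degrees (V : List A) (𝒩 : NonAdjacency A) where

  open NonAdjacency 𝒩

  codeg : A → ℕ
  codeg x = ∑ V (λ y → 𝟙 (N? x y))

  total : ℕ
  total = ∑ V codeg

  codeg<length : ∀ {u} → u ∈ V → codeg u < length V
  codeg<length {u} u∈V = subst (codeg u <_) (trans (∑-const V 1) (*-identityʳ _))
    (∑-mono-< (λ {x} _ → 𝟙≤1 (N? u x)) u∈V (s≤s (≤-reflexive (𝟙-no (N? u u) (N-irrefl refl)))))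

  -- Otherwise M could be enlarged by joining x or y to R, or by exchanging an edge of M for
  -- two edges to x and y.
  exchange : ∀ {x y M R} → N x y → All (λ (u , v) → ¬ N u v) M →
             x ∷ y ∷ flatten M ++ R ↭ V → ¬ CoMatching N V (suc (length M)) →
             2 * length V ≤ codeg x + codeg y + 2 * suc (length M)
  exchange {x} {y} {M} {R} Nxy ¬NM p ¬coM = begin
    2 * length V                                  ≡⟨ cong (2 *_) (sym (↭-length p)) ⟩
    2 * (2 + length (flatten M ++ R))             ≡⟨ cong (λ l → 2 * (2 + l)) (trans (length-++ (flatten M)) (cong (_+ length R) (length-flatten M))) ⟩
    2 * (2 + (length M * 2 + length R))           ≡⟨ regroup (length M) (length R) ⟩
    1 + (1 + (length M * 2 + length R * 2)) + 2 * suc (length M) ≤⟨ +-monoˡ-≤ (2 * suc (length M)) lower ⟩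
    codeg x + codeg y + 2 * suc (length M)        ∎
    where
    open ≤-Reasoning
    regroup : ∀ m r → 2 * (2 + (m * 2 + r)) ≡ 1 + (1 + (m * 2 + r * 2)) + 2 * suc m
    regroup = solve-∀

    h : A → ℕ
    h z = 𝟙 (N? x z) + 𝟙 (N? y z)

    R-joined : ∀ {z} → z ∈ R → 2 ≤ h z
    R-joined {z} z∈R with R′ , q ← ∈⇒↭ z∈R = +-mono-≤
      (𝟙-yes (N? x z) (decidable-stable (N? x z) λ ¬Nxz → ¬coM
        ((x , z) ∷ M , y ∷ R′ , refl , ↭-trans (↭-extend (flatten M) q) p , ¬Nxz ∷ ¬NM)))
      (𝟙-yes (N? y z) (decidable-stable (N? y z) λ ¬Nyz → ¬coM
        ((y , z) ∷ M , x ∷ R′ , refl ,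
          ↭-trans (↭-extend (flatten M) q) (↭-trans (↭-swap y x ↭-refl) p) , ¬Nyz ∷ ¬NM)))

    M-joined : ∀ {u v} → (u , v) ∈ M → 2 ≤ h u + h v
    M-joined {u} {v} uv∈M with M′ , q , r ← ∈⇒↭-flatten uv∈M =
      -- The four indicators are paired by the two possible exchanges of `u v`; each exchange fails,
      -- so each pair contributes at least 1.
      ≤-trans (+-mono-≤ (crossing (N? x u) (N? y v) uv-case) (crossing (N? x v) (N? y u) vu-case))
              (≤-reflexive (cross (𝟙 (N? x u)) (𝟙 (N? y v)) (𝟙 (N? x v)) (𝟙 (N? y u))))
      where
      cross : ∀ a b c d → a + b + (c + d) ≡ a + d + (c + b)
      cross = solve-∀

      ¬NM′ : All (λ (u , v) → ¬ N u v) M′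
      ¬NM′ with _ ∷ rest ← All-resp-↭ q ¬NM = rest

      size : suc (suc (length M′)) ≡ suc (length M)
      size = cong suc (sym (↭-length q))

      uv-case : ¬ (¬ N x u × ¬ N y v)
      uv-case (¬Nxu , ¬Nyv) = ¬coM ((x , u) ∷ (y , v) ∷ M′ , R , size ,
        ↭-trans (↭-cross r) p , ¬Nxu ∷ ¬Nyv ∷ ¬NM′)

      vu-case : ¬ (¬ N x v × ¬ N y u)
      vu-case (¬Nxv , ¬Nyu) = ¬coM ((x , v) ∷ (y , u) ∷ M′ , R , size ,
        ↭-trans (↭-cross (↭-trans r (↭-swap u v ↭-refl))) p , ¬Nxv ∷ ¬Nyu ∷ ¬NM′)

      crossing : ∀ {X Y : Set} (X? : Dec X) (Y? : Dec Y) → ¬ (¬ X × ¬ Y) → 1 ≤ 𝟙 X? + 𝟙 Y?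
      crossing (yes _) _       _ = s≤s z≤n
      crossing (no _)  (yes _) _ = ≤-refl
      crossing (no ¬x) (no ¬y) f = contradiction (¬x , ¬y) f

    lower : 1 + (1 + (length M * 2 + length R * 2)) ≤ codeg x + codeg y
    lower = begin
      1 + (1 + (length M * 2 + length R * 2))
        -- The two leading ones come from `x` and `y` themselves, which are non-adjacent to each
        -- other.
        ≤⟨ +-mono-≤ (≤-trans (𝟙-yes (N? y x) (N-sym Nxy)) (m≤n+m _ (𝟙 (N? x x))))
             (+-mono-≤ (≤-trans (𝟙-yes (N? x y) Nxy) (m≤m+n _ (𝟙 (N? y y))))
               (+-mono-≤ (∑-flatten-≥ M {h} M-joined)
                 (≤-trans (≤-reflexive (sym (∑-const R 2))) (∑-mono R R-joined)))) ⟩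
      h x + (h y + (∑ (flatten M) h + ∑ R h)) ≡⟨ cong (λ k → h x + (h y + k)) (∑-++ (flatten M) R h) ⟨
      ∑ (x ∷ y ∷ flatten M ++ R) h            ≡⟨ ∑-↭ h p ⟩
      ∑ V h                                   ≡⟨ ∑-+ V _ _ ⟩
      codeg x + codeg y                       ∎

  -- By minimality each of the `α` non-neighbours of `v` has codegree at least `β`, and each of the
  -- `β` non-neighbours of `u` at least `α`. Adding these bounds overcounts by at most `α` for each
  -- common non-neighbour. There are at most `α - 1` of those, since `u` is a non-neighbour of `v`
  -- but not of itself.
  total-≥ : ∀ {u v} γ → u ∈ V → v ∈ V → N u v → codeg u ≡ codeg v + γ →
            (∀ {x y} → x ∈ V → y ∈ V → N x y → codeg u + codeg v ≤ codeg x + codeg y) →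
            codeg v * (codeg v + 2 * γ + 1) ≤ total
  total-≥ {u} {v} γ u∈V v∈V Nuv eq minimal =
    +-cancelʳ-≤ (α * α) _ _ (begin
      α * (α + 2 * γ + 1) + α * α                     ≡⟨ regroup α γ ⟩
      α * (α + γ) + (α + γ) * α + α                   ≡⟨ cong (λ k → α * k + k * α + α) (sym eq) ⟩
      α * β + β * α + α                               ≤⟨ +-monoˡ-≤ α summed ⟩
      total + common * α + α                          ≡⟨ +-assoc total _ α ⟩
      total + (common * α + α)                        ≡⟨ cong (total +_) (+-comm _ α) ⟩
      total + suc common * α                          ≤⟨ +-monoʳ-≤ total (*-monoˡ-≤ α common<α) ⟩
      total + α * α                                   ∎)
    where
    open ≤-Reasoning
    α = codeg v
    β = codeg u
    regroup : ∀ α γ → α * (α + 2 * γ + 1) + α * α ≡ α * (α + γ) + (α + γ) * α + α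
    regroup = solve-∀

    common : ℕ
    common = ∑ V (λ x → 𝟙 (N? v x ×-dec N? u x))

    common<α : common < α
    common<α = ∑-mono-< (λ {x} _ → 𝟙-mono (N? v x ×-dec N? u x) (N? v x) proj₁) u∈V
      (≤-trans (s≤s (≤-reflexive (𝟙-no (N? v u ×-dec N? u u) (N-irrefl refl ∘ proj₂))))
               (𝟙-yes (N? v u) (N-sym Nuv)))

    β≤ : ∀ {x} → x ∈ V → N v x → β ≤ codeg x
    β≤ x∈V Nvx = +-cancelˡ-≤ α _ _ (≤-trans (≤-reflexive (+-comm α β)) (minimal v∈V x∈V Nvx))

    pointwise : ∀ {x} → x ∈ V → 𝟙 (N? v x) * β + 𝟙 (N? u x) * α ≤ codeg x + 𝟙 (N? v x ×-dec N? u x) * α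
    pointwise {x} x∈V with N? v x | N? u x
    ... | no _    | no _    = z≤n
    ... | no _    | yes Nux = +-monoˡ-≤ 0 (+-cancelˡ-≤ β _ _ (minimal u∈V x∈V Nux))
    ... | yes Nvx | no _    = +-monoˡ-≤ 0 (≤-trans (≤-reflexive (+-identityʳ β)) (β≤ x∈V Nvx))
    ... | yes Nvx | yes _   = +-monoˡ-≤ (α + 0) (≤-trans (≤-reflexive (+-identityʳ β)) (β≤ x∈V Nvx))

    summed : α * β + β * α ≤ total + common * α
    summed = begin
      α * β + β * α
        ≡⟨ cong₂ _+_ (∑-*ʳ V _ β) (∑-*ʳ V _ α) ⟨
      ∑ V (λ x → 𝟙 (N? v x) * β) + ∑ V (λ x → 𝟙 (N? u x) * α)
        ≡⟨ ∑-+ V _ _ ⟨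
      ∑ V (λ x → 𝟙 (N? v x) * β + 𝟙 (N? u x) * α)
        ≤⟨ ∑-mono V pointwise ⟩
      ∑ V (λ x → codeg x + 𝟙 (N? v x ×-dec N? u x) * α)
        ≡⟨ ∑-+ V _ _ ⟩
      total + ∑ V (λ x → 𝟙 (N? v x ×-dec N? u x) * α)
        ≡⟨ cong (total +_) (∑-*ʳ V _ α) ⟩
      total + common * α
        ∎

  -- Codegrees complement degrees, so a least codegree sum is a largest degree sum.
  MinimalPair : A → A → Set
  MinimalPair u v = u ∈ V × v ∈ V × N u v ×
    (∀ {x y} → x ∈ V → y ∈ V → N x y → codeg u + codeg v ≤ codeg x + codeg y)

  MinimalPair-sym : ∀ {u v} → MinimalPair u v → MinimalPair v u
  MinimalPair-sym {u} {v} (u∈V , v∈V , Nuv , minimal) = v∈V , u∈V , N-sym Nuv ,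
    λ x∈V y∈V Nxy → ≤-trans (≤-reflexive (+-comm (codeg v) (codeg u))) (minimal x∈V y∈V Nxy)

  minimalPair : (∃₂ λ u v → MinimalPair u v) ⊎ (∀ {x y} → x ∈ V → y ∈ V → ¬ N x y)
  minimalPair = search pairs (λ p∈ → let p∈V² , Np = ∈-filter⁻ P? p∈
                                         x∈V , y∈V = ∈-cartesianProduct⁻ V V p∈V² in x∈V , y∈V , Np)
                             (λ x∈V y∈V Nxy → ∈-filter⁺ P? (∈-cartesianProduct⁺ x∈V y∈V) Nxy)
    where
    P? : ∀ p → Dec (uncurry N p)
    P? (x , y) = N? x y
    pairs = filter P? (cartesianProduct V V)
    cost : A × A → ℕ
    cost (x , y) = codeg x + codeg y
    search : ∀ ps → (∀ {x y} → (x , y) ∈ ps → x ∈ V × y ∈ V × N x y) →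
             (∀ {x y} → x ∈ V → y ∈ V → N x y → (x , y) ∈ ps) →
             (∃₂ λ u v → MinimalPair u v) ⊎ (∀ {x y} → x ∈ V → y ∈ V → ¬ N x y)
    search [] _ complete = inj₂ λ x∈V y∈V Nxy → contradiction (complete x∈V y∈V Nxy) λ ()
    search (p ∷ ps) sound complete =
      let u∈V , v∈V , Nuv = argmin-all cost {⊤ = p} {xs = ps}
            {P = λ (x , y) → x ∈ V × y ∈ V × N x y} (sound (here refl)) (All.tabulate (sound ∘ there))
      in inj₁ (_ , _ , u∈V , v∈V , Nuv , λ x∈V y∈V Nxy →
           All.lookup (f[argmin]≤f[⊤] {f = cost} p ps ∷ f[argmin]≤f[xs] {f = cost} p ps) (complete x∈V y∈V Nxy))

-- Closure under adding edges and the Erdős-Gallai bound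

module _ (_≟_ : DecidableEquality A) (V : List A) (V! : Unique V) where

  _∖[_,_] : NonAdjacency A → A → A → NonAdjacency A
  𝒩 ∖[ u , v ] = record
    { N        = λ x y → N x y × ¬ UV x y
    ; N?       = λ x y → N? x y ×-dec ¬? ((x ≟ u ×-dec y ≟ v) ⊎-dec (x ≟ v ×-dec y ≟ u))
    ; N-sym    = λ (Nxy , ¬uv) → N-sym Nxy , ¬uv ∘ UV-sym
    ; N-irrefl = λ x≡y (Nxy , _) → N-irrefl x≡y Nxy
    }
    where
    open NonAdjacency 𝒩
    UV : Rel A 0ℓ
    UV x y = (x ≡ u × y ≡ v) ⊎ (x ≡ v × y ≡ u)
    UV-sym : Symmetric UV
    UV-sym (inj₁ (p , q)) = inj₂ (q , p)
    UV-sym (inj₂ (p , q)) = inj₁ (q , p)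

  -- A new matching of size `s` must use the added edge `u v`. Without that edge it is a matching of
  -- size `s - 1` in the old graph that misses `u` and `v`, and `exchange` then contradicts the
  -- bound on the codegree sum.
  ∖-coMatching : ∀ (𝒩 : NonAdjacency A) {u v s} →
    Degrees.codeg V 𝒩 u + Degrees.codeg V 𝒩 v + 2 * s < 2 * length V → ¬ CoMatching (NonAdjacency.N 𝒩) V s → ¬ CoMatching (NonAdjacency.N (𝒩 ∖[ u , v ])) V s
  ∖-coMatching 𝒩 {u} {v} few ¬coM (M , R , refl , p , ¬N′M)
    with any? (λ (x , y) → NonAdjacency.N? 𝒩 x y) M
  ... | no ¬any = ¬coM (M , R , refl , p , ¬Any⇒All¬ M ¬any)
  ... | yes any with (x , y) , xy∈M , Nxy ← find any
               with M′ , q , r ← ∈⇒↭-flatten xy∈M =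
    <⇒≱ few (subst (λ k → 2 * length V ≤ k) sum-eq
      (Degrees.exchange V 𝒩 Nxy ¬NM′ V↭
        (subst (λ k → ¬ CoMatching (NonAdjacency.N 𝒩) V k) (↭-length q) ¬coM)))
    where
    open NonAdjacency 𝒩
    open Degrees V 𝒩

    V↭ : x ∷ y ∷ flatten M′ ++ R ↭ V
    V↭ = ↭-trans (++⁺ʳ R (↭-sym r)) p

    N-removed : ∀ {x y} → (x , y) ∈ M → N x y → (x ≡ u × y ≡ v) ⊎ (x ≡ v × y ≡ u)
    N-removed {x} {y} xy∈M Nxy = decidable-stable
      ((x ≟ u ×-dec y ≟ v) ⊎-dec (x ≟ v ×-dec y ≟ u)) λ ≢uv → All.lookup ¬N′M xy∈M (Nxy , ≢uv)

    fst∈ : ∀ {w z M} → (w , z) ∈ M → w ∈ flatten {A = A} M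
    fst∈ (here refl) = here refl
    fst∈ (there wz∈) = there (there (fst∈ wz∈))

    snd∈ : ∀ {w z M} → (w , z) ∈ M → z ∈ flatten {A = A} M
    snd∈ (here refl) = there (here refl)
    snd∈ (there wz∈) = there (there (snd∈ wz∈))

    x∉M′ : x ∉ flatten M′
    x∉M′ x∈M′ with x∉ ∷ _ ← Unique-resp-↭ (↭-sym V↭) V! =
      All.lookup x∉ (there (∈-++⁺ˡ x∈M′)) refl

    -- The added edge occurs only once in `M`: a second copy would repeat the vertex `x`.
    ¬NM′ : All (λ (w , z) → ¬ N w z) M′
    ¬NM′ = All.tabulate λ {(w , z)} wz∈M′ Nwz → x∉M′
      (meet (N-removed xy∈M Nxy) (N-removed (∈-resp-↭ (↭-sym q) (there wz∈M′)) Nwz) wz∈M′)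
      where
      meet : ∀ {w z} → (x ≡ u × y ≡ v) ⊎ (x ≡ v × y ≡ u) → (w ≡ u × z ≡ v) ⊎ (w ≡ v × z ≡ u) →
             (w , z) ∈ M′ → x ∈ flatten M′
      meet (inj₁ (refl , refl)) (inj₁ (refl , refl)) wz∈ = fst∈ wz∈
      meet (inj₁ (refl , refl)) (inj₂ (refl , refl)) wz∈ = snd∈ wz∈
      meet (inj₂ (refl , refl)) (inj₁ (refl , refl)) wz∈ = snd∈ wz∈
      meet (inj₂ (refl , refl)) (inj₂ (refl , refl)) wz∈ = fst∈ wz∈

    sum-eq : codeg x + codeg y + 2 * suc (length M′) ≡ codeg u + codeg v + 2 * length M
    sum-eq = cong₂ (λ k l → k + 2 * l) (ends (N-removed xy∈M Nxy)) (sym (↭-length q))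
      where
      ends : (x ≡ u × y ≡ v) ⊎ (x ≡ v × y ≡ u) → codeg x + codeg y ≡ codeg u + codeg v
      ends (inj₁ (refl , refl)) = refl
      ends (inj₂ (refl , refl)) = +-comm (codeg v) (codeg u)

  -- The Erdős–Gallai bound on the edges of a graph without a matching of size s, in terms
  -- of the non-edges. While some non-adjacent pair has degree sum at least 2s - 1, adding it
  -- as an edge creates no matching of size s (Bondy–Chvátal closure). In the closed graph
  -- a non-adjacent pair of maximal degree sum bounds all other degrees.
  erdős–gallai : ∀ {s} → 2 * s ≤ length V → (𝒩 : NonAdjacency A) → ¬ CoMatching (NonAdjacency.N 𝒩) V s →
    ∃₂ λ α γ → α + γ < length V × 2 * length V ≤ 2 * α + γ + 2 * s ×
               α * (α + 2 * γ + 1) ≤ Degrees.total V 𝒩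
  erdős–gallai {s} 2s≤V 𝒩₀ = go _ 𝒩₀ ≤-refl
    where
    -- `k` strictly bounds `total`, which drops with every added edge.
    go : ∀ k (𝒩 : NonAdjacency A) → Degrees.total V 𝒩 < k → ¬ CoMatching (NonAdjacency.N 𝒩) V s →
      ∃₂ λ α γ → α + γ < length V × 2 * length V ≤ 2 * α + γ + 2 * s ×
                 α * (α + 2 * γ + 1) ≤ Degrees.total V 𝒩
    go (suc k) 𝒩 (s≤s total≤k) ¬coM = conclude minimalPair
      where
      open NonAdjacency 𝒩
      open Degrees V 𝒩
      Goal : Set
      Goal = ∃₂ λ α γ → α + γ < length V × 2 * length V ≤ 2 * α + γ + 2 * s × α * (α + 2 * γ + 1) ≤ total

      ordered : ∀ {u v} → MinimalPair u v → codeg v ≤ codeg u → Goal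
      ordered {u} {v} (u∈V , v∈V , Nuv , minimal) v≤u
        with codeg u + codeg v + 2 * s <? 2 * length V
      ... | yes few =
        let α , γ , α+γ< , 2V≤ , ≤total = go k (𝒩 ∖[ u , v ]) (<-≤-trans fewer total≤k) (∖-coMatching 𝒩 few ¬coM)
        -- The bound for the larger graph carries back, because adding an edge only lowers `total`.
        in α , γ , α+γ< , 2V≤ , ≤-trans ≤total (<⇒≤ fewer)
        where
        N′? : Decidable (NonAdjacency.N (𝒩 ∖[ u , v ]))
        N′? = NonAdjacency.N? (𝒩 ∖[ u , v ])
        fewer : Degrees.total V (𝒩 ∖[ u , v ]) < total
        fewer = ∑-mono-< (λ {x} _ → ∑-mono V λ {y} _ → 𝟙-mono (N′? x y) (N? x y) proj₁) u∈V
          (∑-mono-< (λ {y} _ → 𝟙-mono (N′? u y) (N? u y) proj₁) v∈V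
            (≤-trans (s≤s (≤-reflexive (𝟙-no (N′? u v) λ (_ , ¬uv) → ¬uv (inj₁ (refl , refl)))))
                     (𝟙-yes (N? u v) Nuv)))
      ... | no ¬few with γ , eq ← m≤n⇒∃[o]m+o≡n v≤u =
        codeg v , γ , subst (_< length V) (sym eq) (codeg<length u∈V) ,
        ≤-trans (≮⇒≥ ¬few) (≤-reflexive (cong (_+ 2 * s) (trans (cong (_+ codeg v) (sym eq)) (regroup (codeg v) γ)))) ,
        total-≥ γ u∈V v∈V Nuv (sym eq) minimal
        where
        regroup : ∀ α γ → α + γ + α ≡ 2 * α + γ
        regroup = solve-∀

      conclude : (∃₂ λ u v → MinimalPair u v) ⊎ (∀ {x y} → x ∈ V → y ∈ V → ¬ N x y) → Goal
      -- A complete graph on at least `2 * s` vertices has a matching of size `s`.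
      conclude (inj₂ ¬N) = contradiction (complete-coMatching s V 2s≤V ¬N) ¬coM
      conclude (inj₁ (u , v , uv-min)) with ≤-total (codeg v) (codeg u)
      ... | inj₁ v≤u = ordered uv-min v≤u
      ... | inj₂ u≤v = ordered (MinimalPair-sym uv-min) u≤v

-- The constant

-- Certificate form without subtraction: `y - x = r - l` is left to the ring solver.
≤-cert : ∀ {x y l r} → l ≤ r → x + r ≡ y + l → x ≤ y
≤-cert {x} {y} {l} {r} l≤r eq = +-cancelʳ-≤ r x y (≤-trans (≤-reflexive eq) (+-monoʳ-≤ y l≤r))

-- This is `(r - l) * (r′ - l′) ≥ 0` multiplied out, so that a product of two inequalities can enter
-- a certificate.
rearrangement : ∀ {l r l′ r′} → l ≤ r → l′ ≤ r′ → l * r′ + r * l′ ≤ l * l′ + r * r′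
rearrangement {l} {_} {l′} l≤r l′≤r′ with k , refl ← m≤n⇒∃[o]m+o≡n l≤r | k′ , refl ← m≤n⇒∃[o]m+o≡n l′≤r′ =
  ≤-trans (m≤m+n _ (k * k′)) (≤-reflexive (expand l k l′ k′))
  where
  expand : ∀ l k l′ k′ → l * (l′ + k′) + (l + k) * l′ + k * k′ ≡ l * l′ + (l + k) * (l′ + k′)
  expand = solve-∀

-- (15 + √33) / 24 is the larger root of 12 x² - 15 x + 4.
module Constant (a b : ℕ) (0<b : 0 < b) (root : 12 * (a * a) + 4 * (b * b) ≤ 15 * (a * b)) where

  private instance
    b≢0 : NonZero b
    b≢0 = >-nonZero 0<b

  -- For `a = b + k` the quadratic `12 a² - 15 a b + 4 b²` equals `b² + 9 b k + 12 k²`, which is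
  -- positive and contradicts `root`.
  a≤b : a ≤ b
  a≤b with a ≤? b
  ... | yes a≤b = a≤b
  ... | no a≰b with k , refl ← m≤n⇒∃[o]m+o≡n (<⇒≤ (≰⇒> a≰b)) =
    contradiction root (<⇒≱ (≤-trans (+-monoˡ-≤ (15 * ((b + k) * b)) (*-mono-≤ 0<b 0<b))
      (≤-trans (m≤m+n _ (9 * (b * k) + 12 * (k * k))) (≤-reflexive (expand b k)))))
    where
    expand : ∀ b k → b * b + 15 * ((b + k) * b) + (9 * (b * k) + 12 * (k * k))
                   ≡ 12 * ((b + k) * (b + k)) + 4 * (b * b)
    expand = solve-∀

  -- On the range 0 ≤ e ≤ (2 a / b - 1) d, where d = α + e, the concave quadratic
  -- (d - e) (d + 3 e) - (a / b) d² is nonnegative because it is so at both ends.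
  concave-bound : ∀ α e → b * (α + 2 * e) ≤ 2 * (a * (α + e)) →
                  a * ((α + e) * (α + e)) ≤ b * (α * (α + 4 * e))
  concave-bound α e h = *-cancelˡ-≤ b (by-cases (≤-total (6 * a) (5 * b)))
    where
    d = α + e
    by-cases : 6 * a ≤ 5 * b ⊎ 5 * b ≤ 6 * a → b * (a * (d * d)) ≤ b * (b * (α * (α + 4 * e)))
    -- The difference of the two sides is `3 b e` times the slack of `h`, plus a remainder
    -- `d b e (5 b - 6 a) + b d² (b - a)`. Here the remainder has nonnegative terms.
    by-cases (inj₁ 6a≤5b) = ≤-cert
      (+-mono-≤ (*-monoʳ-≤ (3 * (b * e)) h)
        (+-mono-≤ (*-monoʳ-≤ (d * (b * e)) 6a≤5b) (*-monoʳ-≤ (b * (d * d)) a≤b)))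
      (identity a b α e)
      where
      identity : ∀ a b α e →
        b * (a * ((α + e) * (α + e))) + (3 * (b * e) * (2 * (a * (α + e))) +
          ((α + e) * (b * e) * (5 * b) + b * ((α + e) * (α + e)) * b))
        ≡ b * (b * (α * (α + 4 * e))) + (3 * (b * e) * (b * (α + 2 * e)) +
          ((α + e) * (b * e) * (6 * a) + b * ((α + e) * (α + e)) * a))
      identity = solve-∀
    -- Now the remainder decreases in `e`. At the right end of the range it is
    -- `d² (15 a b - 12 a² - 4 b²)`, which is nonnegative by `root`.
    by-cases (inj₂ 5b≤6a) = ≤-cert
      (+-mono-≤ (*-monoʳ-≤ (3 * (b * e)) h)
        (+-mono-≤ (*-monoʳ-≤ d (rearrangement 5b≤6a h)) (*-monoʳ-≤ (d * d) root)))
      (identity a b α e)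
      where
      identity : ∀ a b α e →
        b * (a * ((α + e) * (α + e))) + (3 * (b * e) * (2 * (a * (α + e))) +
          ((α + e) * (5 * b * (b * (α + 2 * e)) + 6 * a * (2 * (a * (α + e)))) +
           (α + e) * (α + e) * (15 * (a * b))))
        ≡ b * (b * (α * (α + 4 * e))) + (3 * (b * e) * (b * (α + 2 * e)) +
          ((α + e) * (5 * b * (2 * (a * (α + e))) + 6 * a * (b * (α + 2 * e))) +
           (α + e) * (α + e) * (12 * (a * a) + 4 * (b * b))))
      identity = solve-∀

  -- Converts the output `α`, `γ` of `erdős–gallai` into more than `(a / b) d²` owned pairs. If
  -- `d = α + e`, then `2 * e ≤ γ`, and the worst case `γ = 2 * e` is `concave-bound`; the final
  -- `+ 1` makes the inequality strict.
  light-bound : ∀ {d w} α γ → 1 ≤ d → b * w ≤ 2 * (a * d) → α + γ < w → 2 * d ≤ 2 * α + γ →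
                a * (d * d) < b * (α * (α + 2 * γ + 1))
  light-bound {d} {w} α γ 1≤d light α+γ<w 2d≤ with d ≤? α
  ... | yes d≤α = begin-strict
    a * (d * d)                      ≤⟨ *-monoˡ-≤ (d * d) a≤b ⟩
    b * (d * d)                      <⟨ *-monoʳ-< b (*-monoʳ-< d ⦃ >-nonZero 1≤d ⦄ (n<1+n d)) ⟩
    b * (d * suc d)                  ≤⟨ *-monoʳ-≤ b (*-mono-≤ d≤α (≤-trans (s≤s (≤-trans d≤α (m≤m+n α (2 * γ)))) (≤-reflexive (+-comm 1 _)))) ⟩
    b * (α * (α + 2 * γ + 1))        ∎
    where open ≤-Reasoning
  ... | no d≰α with e , refl ← m≤n⇒∃[o]m+o≡n (<⇒≤ (≰⇒> d≰α)) = begin-strict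
    a * ((α + e) * (α + e))          ≤⟨ concave-bound α e (<⇒≤ h) ⟩
    b * (α * (α + 4 * e))            <⟨ *-monoʳ-< b (*-monoʳ-< α ⦃ >-nonZero 0<α ⦄ 4e<) ⟩
    b * (α * (α + 2 * γ + 1))        ∎
    where
    open ≤-Reasoning
    2e≤γ : 2 * e ≤ γ
    2e≤γ = +-cancelˡ-≤ (2 * α) _ _ (≤-trans (≤-reflexive (sym (*-distribˡ-+ 2 α e))) 2d≤)

    h : b * (α + 2 * e) < 2 * (a * (α + e))
    h = <-≤-trans (*-monoʳ-< b (≤-<-trans (+-monoʳ-≤ α 2e≤γ) α+γ<w)) light

    4e< : α + 4 * e < α + 2 * γ + 1
    4e< = ≤-trans (s≤s (+-monoʳ-≤ α (≤-trans (≤-reflexive (double e)) (*-monoʳ-≤ 2 2e≤γ)))) (≤-reflexive (+-comm 1 _))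
      where
      double : ∀ e → 4 * e ≡ 2 * (2 * e)
      double = solve-∀

    0<α : 0 < α
    0<α = n≢0⇒n>0 λ { refl → <⇒≱ (subst (_< 2 * (a * e)) (assoc b e) h) (*-monoʳ-≤ 2 (*-monoˡ-≤ e a≤b)) }
      where
      assoc : ∀ b e → b * (2 * e) ≡ 2 * (b * e)
      assoc = solve-∀

  -- The heaviness threshold `2 d + 1` is exactly the gap between `d²` and `(d + 1)²`.
  heavy-step : ∀ {d w m n} → a * suc (d + d) ≤ b * w → a * (d * d) < b * m → m + w ≤ n →
               a * (suc d * suc d) < b * n
  heavy-step {d} {w} {m} {n} heavy ih m+w≤n = begin-strict
    a * (suc d * suc d)              ≡⟨ square a d ⟩
    a * (d * d) + a * suc (d + d)    <⟨ +-mono-<-≤ ih heavy ⟩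
    b * m + b * w                    ≡⟨ *-distribˡ-+ b m w ⟨
    b * (m + w)                      ≤⟨ *-monoʳ-≤ b m+w≤n ⟩
    b * n                            ∎
    where
    open ≤-Reasoning
    square : ∀ a d → a * (suc d * suc d) ≡ a * (d * d) + a * suc (d + d)
    square = solve-∀

-- The irrational constant is replaced by a rational `a / b` between the two roots and at least
-- `n / d²`. Up to `15 / 24` the value `5 / 8` serves, beyond it `n / d²` itself.
BelowBound⇒constant : ∀ {n d} → 0 < d → BelowBound n (suc d) →
  ∃₂ λ a b → 0 < b × 12 * (a * a) + 4 * (b * b) ≤ 15 * (a * b) × b * n ≤ a * (d * d)
BelowBound⇒constant {n} {d} 0<d (inj₁ 24n≤15s) =
  5 , 8 , s≤s z≤n , ≤ᵇ⇒≤ 556 600 _ , *-cancelˡ-≤ 3 (begin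
    3 * (8 * n)        ≡⟨ *-assoc 3 8 n ⟨
    24 * n             ≤⟨ 24n≤15s ⟩
    15 * (d ^ 2)       ≡⟨ cong (15 *_) (cong (d *_) (*-identityʳ d)) ⟩
    15 * (d * d)       ≡⟨ *-assoc 3 5 (d * d) ⟩
    3 * (5 * (d * d))  ∎)
  where open ≤-Reasoning
BelowBound⇒constant {n} {d} 0<d (inj₂ (15s<24n , k²<33s²)) =
  n , d * d , *-mono-≤ 0<d 0<d , root , ≤-reflexive (*-comm (d * d) n)
  where
  s = d * d
  s≡ : d ^ 2 ≡ s
  s≡ = cong (d *_) (*-identityʳ d)
  k = 24 * n ∸ 15 * (d ^ 2)
  24n≡ : 15 * s + k ≡ 24 * n
  24n≡ = trans (cong (λ x → 15 * x + k) (sym s≡)) (m+[n∸m]≡n (<⇒≤ 15s<24n))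
  k² : k * k ≤ 33 * (s * s)
  k² = <⇒≤ (subst (_< 33 * (s * s)) (cong (k *_) (*-identityʳ k))
    (subst (λ x → k ^ 2 < 33 * x) (trans (cong (_^ 2) s≡) (cong (s *_) (*-identityʳ s))) k²<33s²))
  -- 48 times the claim, after 24 n = 15 s + k.
  root : 12 * (n * n) + 4 * (s * s) ≤ 15 * (n * s)
  root = *-cancelˡ-≤ 48 (begin
    48 * (12 * (n * n) + 4 * (s * s))                    ≡⟨ lhs n s ⟩
    24 * n * (24 * n) + 192 * (s * s)                    ≡⟨ cong (λ x → x * x + 192 * (s * s)) (sym 24n≡) ⟩
    (15 * s + k) * (15 * s + k) + 192 * (s * s)          ≤⟨ ≤-cert k² (middle s k) ⟩
    30 * s * (15 * s + k)                                ≡⟨ cong (30 * s *_) 24n≡ ⟩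
    30 * s * (24 * n)                                    ≡⟨ rhs n s ⟩
    48 * (15 * (n * s))                                  ∎)
    where
    open ≤-Reasoning
    lhs : ∀ n s → 48 * (12 * (n * n) + 4 * (s * s)) ≡ 24 * n * (24 * n) + 192 * (s * s)
    lhs = solve-∀
    middle : ∀ s k → (15 * s + k) * (15 * s + k) + 192 * (s * s) + 33 * (s * s) ≡ 30 * s * (15 * s + k) + k * k
    middle = solve-∀
    rhs : ∀ n s → 30 * s * (24 * n) ≡ 48 * (15 * (n * s))
    rhs = solve-∀

-- Counting in filtered lists

length-filter-∁ : ∀ {P : A → Set} (P? : ∀ x → Dec (P x)) xs →
                  length (filter (¬? ∘ P?) xs) + length (filter P? xs) ≡ length xs
length-filter-∁ P? [] = refl
length-filter-∁ P? (x ∷ xs) with P? x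
... | yes _ = trans (+-suc _ _) (cong suc (length-filter-∁ P? xs))
... | no _  = cong suc (length-filter-∁ P? xs)

-- `length M + length R` is kept together because it is the size of the cover built from `M` and
-- `R`.
coMatching-size : ∀ (M : List (A × A)) {R V} → flatten M ++ R ↭ V →
                  length M + length R + length M ≡ length V
coMatching-size M {R} {V} V↭ = begin
  length M + length R + length M   ≡⟨ regroup (length M) (length R) ⟩
  length M * 2 + length R          ≡⟨ cong (_+ length R) (length-flatten M) ⟨
  length (flatten M) + length R    ≡⟨ length-++ (flatten M) ⟨
  length (flatten M ++ R)          ≡⟨ ↭-length V↭ ⟩
  length V                         ∎
  where
  open ≡-Reasoning
  regroup : ∀ m r → m + r + m ≡ m * 2 + r
  regroup = solve-∀

module Remove (_≟_ : DecidableEquality A) where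

  remove : A → List A → List A
  remove x = filter (λ y → ¬? (y ≟ x))

  ∈-remove⁻ : ∀ {x y xs} → y ∈ remove x xs → y ∈ xs × y ≢ x
  ∈-remove⁻ {x} = ∈-filter⁻ (λ y → ¬? (y ≟ x))

  ∈-remove⁺ : ∀ {x y xs} → y ∈ xs → y ≢ x → y ∈ remove x xs
  ∈-remove⁺ {x} = ∈-filter⁺ (λ y → ¬? (y ≟ x))

  remove-! : ∀ x {xs} → Unique xs → Unique (remove x xs)
  remove-! x = Unique-filter⁺ (λ y → ¬? (y ≟ x))

  length-remove-≥ : ∀ x {xs} → Unique xs → length xs ≤ suc (length (remove x xs))
  length-remove-≥ x xs! = Unique-⊆⇒length-≤ xs! λ {y} y∈ → case y ≟ x of λ where
    (yes refl) → here refl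
    (no y≢x)   → there (∈-remove⁺ y∈ y≢x)

  length-remove-< : ∀ {x xs} → Unique xs → x ∈ xs → length (remove x xs) < length xs
  length-remove-< {x} {xs} xs! x∈ = Unique-⊆⇒length-≤ {xs = x ∷ remove x xs}
    (All.tabulate (λ y∈ x≡y → proj₂ (∈-remove⁻ {xs = xs} y∈) (sym x≡y)) ∷ remove-! x xs!)
    λ { (here refl) → x∈ ; (there y∈) → proj₁ (∈-remove⁻ {xs = xs} y∈) }

-- Cover-free families

module Family (_≟ᴬ_ : DecidableEquality A) (_≟ᴮ_ : DecidableEquality B)
              (_∋_ : A → B → Set) (_∋?_ : ∀ F p → Dec (F ∋ p)) where

  open Remove

  -- `Gs` may contain repetitions, so covers can be assembled greedily.
  CoverFree : ℕ → List A → List B → Set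
  CoverFree d L P = ∀ {F} Gs → F ∈ L → Gs ⊆ L → F ∉ Gs → length Gs ≤ d →
    ∃ λ p → p ∈ P × F ∋ p × All (λ G → ¬ G ∋ p) Gs

  NoPrivate : List A → List B → Set
  NoPrivate L P = ∀ {F p} → F ∈ L → p ∈ P → F ∋ p → ∃ λ G → G ∈ L × G ≢ F × G ∋ p

  Private : List A → A → B → Set
  Private L F p = F ∋ p × All (λ G → G ≡ F ⊎ ¬ G ∋ p) L

  private? : ∀ L P → (∃₂ λ F p → F ∈ L × p ∈ P × Private L F p) ⊎ NoPrivate L P
  private? L P with any? (λ F → any? (λ p → F ∋? p ×-dec all? (λ G → G ≟ᴬ F ⊎-dec ¬? (G ∋? p)) L) P) L
  ... | yes found with F , F∈L , foundF ← find found with p , p∈P , priv ← find foundF =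
    inj₁ (F , p , F∈L , p∈P , priv)
  ... | no none = inj₂ λ {F} {p} F∈L p∈P F∋p → other F p λ lonely → none (lose F∈L (lose p∈P (F∋p , lonely)))
    where
    other : ∀ F p → ¬ All (λ G → G ≡ F ⊎ ¬ G ∋ p) L → ∃ λ G → G ∈ L × G ≢ F × G ∋ p
    other F p ¬lonely
      with G , G∈L , ¬either ← find (¬All⇒Any¬ (λ G → G ≟ᴬ F ⊎-dec ¬? (G ∋? p)) L ¬lonely) =
      G , G∈L , ¬either ∘ inj₁ , decidable-stable (G ∋? p) (¬either ∘ inj₂)

  -- The result of deleting private points together with their members while more than k
  -- members are left.
  record Core (k : ℕ) (L : List A) (P : List B) : Set where
    field
      L′        : List A
      P′        : List B
      L′!       : Unique L′
      P′!       : Unique P′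
      L′⊆L      : L′ ⊆ L
      P′≤P      : length P′ ≤ length P
      -- Survivors keep all their points, so cover-freeness passes to the core.
      points⊆P′ : ∀ {F p} → F ∈ L′ → p ∈ P → F ∋ p → p ∈ P′
      -- The surplus of members over points does not shrink: each deleted member takes a point with
      -- it.
      balance   : length L + length P′ ≤ length P + length L′
      k≤L′      : k ≤ length L′
      stuck     : NoPrivate L′ P′ ⊎ length L′ ≤ k

    coverFree : ∀ {d} → CoverFree d L P → CoverFree d L′ P′
    coverFree cf Gs F∈L′ Gs⊆L′ F∉Gs size
      with p , p∈P , F∋p , ∌p ← cf Gs (L′⊆L F∈L′) (L′⊆L ∘ Gs⊆L′) F∉Gs size =
      p , points⊆P′ F∈L′ p∈P F∋p , F∋p , ∌p

  core : ∀ k {L P} → Unique L → Unique P → k ≤ length L → Core k L P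
  core k {L} L! P! = go (length L) ≤-refl L! P!
    where
    go : ∀ m {L P} → length L ≤ m → Unique L → Unique P → k ≤ length L → Core k L P
    go m {L} {P} L≤m L! P! k≤L with length L ≤? k | private? L P
    ... | yes L≤k | _ = record
      { L′! = L! ; P′! = P! ; L′⊆L = λ x∈ → x∈ ; P′≤P = ≤-refl ; points⊆P′ = λ _ p∈ _ → p∈
      ; balance = ≤-reflexive (+-comm (length L) _) ; k≤L′ = k≤L ; stuck = inj₂ L≤k }
    ... | no _ | inj₂ noPrivate = record
      { L′! = L! ; P′! = P! ; L′⊆L = λ x∈ → x∈ ; P′≤P = ≤-refl ; points⊆P′ = λ _ p∈ _ → p∈
      ; balance = ≤-reflexive (+-comm (length L) _) ; k≤L′ = k≤L ; stuck = inj₁ noPrivate }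
    go zero    L≤0 _ _ _ | no L≰k | inj₁ _ = contradiction (≤-trans L≤0 z≤n) L≰k
    go (suc m) {L} {P} L≤m L! P! _ | no L≰k | inj₁ (F , p , F∈L , p∈P , F∋p , lonely) = record
      { L′! = L′! ; P′! = P′! ; L′⊆L = proj₁ ∘ ∈-remove⁻ _≟ᴬ_ ∘ L′⊆L
      ; P′≤P = ≤-trans P′≤P (<⇒≤ P₁<P)
      ; points⊆P′ = λ {G} {q} G∈L′ q∈P G∋q → points⊆P′ G∈L′
          (∈-remove⁺ _≟ᴮ_ q∈P (λ { refl → avoids (L′⊆L G∈L′) G∋q })) G∋q
      ; balance = s≤s⁻¹ (≤-trans (+-monoˡ-≤ _ (s≤s L≤L₁)) (≤-trans (s≤s (s≤s balance)) (s≤s (+-monoˡ-≤ _ P₁<P))))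
      ; k≤L′ = k≤L′ ; stuck = stuck }
      where
      L₁ = remove _≟ᴬ_ F L
      P₁ = remove _≟ᴮ_ p P
      L≤L₁ : length L ≤ suc (length L₁)
      L≤L₁ = length-remove-≥ _≟ᴬ_ F L!
      P₁<P : length P₁ < length P
      P₁<P = length-remove-< _≟ᴮ_ P! p∈P
      C : Core k L₁ P₁
      C = go m (s≤s⁻¹ (≤-trans (length-remove-< _≟ᴬ_ L! F∈L) L≤m))
        (remove-! _≟ᴬ_ F L!) (remove-! _≟ᴮ_ p P!) (s≤s⁻¹ (≤-trans (≰⇒> L≰k) L≤L₁))
      open Core C
      avoids : ∀ {G} → G ∈ L₁ → ¬ G ∋ p
      avoids G∈L₁ G∋p with G∈L , G≢F ← ∈-remove⁻ _≟ᴬ_ G∈L₁ with All.lookup lonely G∈L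
      ... | inj₁ G≡F = G≢F G≡F
      ... | inj₂ ¬G∋p = ¬G∋p G∋p

  points : A → List B → List B
  points F = filter (F ∋?_)

  Own : List A → A → Rel B 0ℓ
  Own L F x y = x ≢ y × F ∋ x × F ∋ y × All (λ G → G ≡ F ⊎ ¬ (G ∋ x × G ∋ y)) L

  own? : ∀ L F → Decidable (Own L F)
  own? L F x y = ¬? (x ≟ᴮ y) ×-dec F ∋? x ×-dec F ∋? y ×-dec
                 all? (λ G → G ≟ᴬ F ⊎-dec ¬? (G ∋? x ×-dec G ∋? y)) L

  -- Among distinct points of `F`, the edges of this graph are the pairs that lie together in
  -- another member, so that one member can cover both ends.
  own : List A → A → NonAdjacency B
  own L F = record
    { N        = Own L F
    ; N?       = own? L F
    ; N-sym    = λ (x≢y , F∋x , F∋y , only) →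
        x≢y ∘ sym , F∋y , F∋x , All.map (Sum.map₂ (λ ¬xy (y , x) → ¬xy (x , y))) only
    ; N-irrefl = λ x≡y (x≢y , _) → x≢y x≡y
    }

  ¬own⇒shared : ∀ {L F x y} → x ≢ y → F ∋ x → F ∋ y → ¬ Own L F x y →
                ∃ λ G → G ∈ L × G ≢ F × G ∋ x × G ∋ y
  ¬own⇒shared {L} {F} {x} {y} x≢y F∋x F∋y ¬own
    with G , G∈L , ¬either ← find (¬All⇒Any¬ (λ G → G ≟ᴬ F ⊎-dec ¬? (G ∋? x ×-dec G ∋? y)) L
           λ only → ¬own (x≢y , F∋x , F∋y , only)) =
    G , G∈L , ¬either ∘ inj₁ , decidable-stable (G ∋? x ×-dec G ∋? y) (¬either ∘ inj₂)

  ownPairs : List A → List B → A → ℕ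
  ownPairs L P F = ∑ P (λ x → ∑ P (λ y → 𝟙 (own? L F x y)))

  -- Double counting: each ordered pair of points has at most one owner.
  ∑-ownPairs-≤ : ∀ {L} P → Unique L → ∑ L (ownPairs L P) ≤ length P * length P
  ∑-ownPairs-≤ {L} P L! = begin
    ∑ L (ownPairs L P)
      ≡⟨ ∑-swap L P _ ⟩
    ∑ P (λ x → ∑ L (λ F → ∑ P (λ y → 𝟙 (own? L F x y))))
      ≤⟨ ∑-mono P (λ {x} _ → begin
           ∑ L (λ F → ∑ P (λ y → 𝟙 (own? L F x y))) ≡⟨ ∑-swap L P _ ⟩
           ∑ P (λ y → ∑ L (λ F → 𝟙 (own? L F x y))) ≤⟨ ∑-mono P (λ {y} _ → count-≤1 (λ F → own? L F x y) L! owner-unique) ⟩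
           ∑ P (const 1)                            ≡⟨ ∑-const P 1 ⟩
           length P * 1                             ≡⟨ *-identityʳ _ ⟩
           length P                                 ∎) ⟩
    ∑ P (const (length P))
      ≡⟨ ∑-const P (length P) ⟩
    length P * length P
      ∎
    where
    open ≤-Reasoning
    owner-unique : ∀ {F G x y} → F ∈ L → G ∈ L → Own L F x y → Own L G x y → F ≡ G
    owner-unique F∈L _ (_ , F∋x , F∋y , _) (_ , _ , _ , only) with All.lookup only F∈L
    ... | inj₁ F≡G = F≡G
    ... | inj₂ ¬xy = contradiction (F∋x , F∋y) ¬xy

  -- Each pair of M lies in one other member because F does not own it, and each point of R
  -- because it is not private.
  coMatching⇒cover : ∀ {L P F} → NoPrivate L P → F ∈ L → ∀ M R → Unique (flatten M ++ R) →
    flatten M ++ R ⊆ points F P → All (λ (x , y) → ¬ Own L F x y) M →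
    ∃ λ Gs → length Gs ≡ length M + length R × Gs ⊆ L × F ∉ Gs ×
             All (λ p → Any (_∋ p) Gs) (flatten M ++ R)
  coMatching⇒cover _ _ [] [] _ _ _ = [] , refl , (λ ()) , (λ ()) , []
  coMatching⇒cover {L} {P} {F} np F∈L [] (z ∷ R) (_ ∷ R!) R⊆ []
    with Gs , size , Gs⊆L , F∉Gs , covered ← coMatching⇒cover np F∈L [] R R! (R⊆ ∘ there) []
    with z∈P , F∋z ← ∈-filter⁻ (F ∋?_) {xs = P} (R⊆ (here refl))
    with G , G∈L , G≢F , G∋z ← np F∈L z∈P F∋z =
    G ∷ Gs , cong suc size , (λ { (here refl) → G∈L ; (there H∈) → Gs⊆L H∈ }) ,
    (λ { (here F≡G) → G≢F (sym F≡G) ; (there F∈) → F∉Gs F∈ }) ,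
    here G∋z ∷ All.map there covered
  coMatching⇒cover {L} {P} {F} np F∈L ((x , y) ∷ M) R ((x≢y ∷ _) ∷ (_ ∷ MR!)) MR⊆ (¬own ∷ ¬ownM)
    with Gs , size , Gs⊆L , F∉Gs , covered ← coMatching⇒cover np F∈L M R MR! (MR⊆ ∘ there ∘ there) ¬ownM
    with _ , F∋x ← ∈-filter⁻ (F ∋?_) {xs = P} (MR⊆ (here refl))
    with _ , F∋y ← ∈-filter⁻ (F ∋?_) {xs = P} (MR⊆ (there (here refl)))
    with G , G∈L , G≢F , G∋x , G∋y ← ¬own⇒shared x≢y F∋x F∋y ¬own =
    G ∷ Gs , cong suc size , (λ { (here refl) → G∈L ; (there H∈) → Gs⊆L H∈ }) ,
    (λ { (here F≡G) → G≢F (sym F≡G) ; (there F∈) → F∉Gs F∈ }) ,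
    here G∋x ∷ here G∋y ∷ All.map there covered

  -- A matching of size `m` would give a cover of `F` by `length (points F P) - m` other members,
  -- which is at most `d`.
  no-large-coMatching : ∀ {d L P F m} → Unique P → CoverFree d L P → NoPrivate L P → F ∈ L →
    length (points F P) ≤ d + m → ¬ CoMatching (Own L F) (points F P) m
  no-large-coMatching {d} {L} {P} {F} P! cf np F∈L V≤d+m (M , R , refl , V↭ , ¬ownM)
    with Gs , size , Gs⊆L , F∉Gs , covered ← coMatching⇒cover np F∈L M R
           (Unique-resp-↭ (↭-sym V↭) (Unique-filter⁺ (F ∋?_) P!)) (∈-resp-↭ V↭) ¬ownM
    with p , p∈P , F∋p , ∌p ← cf Gs F∈L Gs⊆L F∉Gs
           (≤-trans (≤-reflexive size) (+-cancelʳ-≤ (length M) _ _ (≤-trans (≤-reflexive (coMatching-size M V↭)) V≤d+m))) =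
    All¬⇒¬Any ∌p (All.lookup covered (∈-resp-↭ (↭-sym V↭) (∈-filter⁺ (F ∋?_) p∈P F∋p)))

  -- The case of the empty matching: with at most `d` points, `F` could be covered point by point.
  d<points : ∀ {d L P F} → Unique P → CoverFree d L P → NoPrivate L P → F ∈ L → d < length (points F P)
  d<points {d} P! cf np F∈L = ≰⇒> λ V≤d → no-large-coMatching P! cf np F∈L
    (≤-trans V≤d (m≤m+n d 0)) ([] , _ , refl , ↭-refl , [])

  -- The bound for cover-free families, by induction on `d`

  module Bound (a b : ℕ) (0<b : 0 < b) (root : 12 * (a * a) + 4 * (b * b) ≤ 15 * (a * b)) where

    open Constant a b 0<b root

    private instance
      b≢0 : NonZero b
      b≢0 = >-nonZero 0<b

    ManyPoints : ℕ → Set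
    ManyPoints d = ∀ {L P} → Unique L → Unique P → CoverFree d L P → length P < length L →
                a * (d * d) < b * length P

    light-ownPairs : ∀ {d L P F} → Unique P → CoverFree (suc d) L P → NoPrivate L P → F ∈ L →
      b * length (points F P) < a * suc (d + d) → a * (suc d * suc d) < b * ownPairs L P F
    light-ownPairs {d} {L} {P} {F} P! cf np F∈L light
      -- The forbidden matching size is `s = w - (d + 1)`. With it, the Erdős-Gallai inequality
      -- `2 * w ≤ 2 * α + γ + 2 * s` reduces to `2 * suc d ≤ 2 * α + γ`.
      with s , w≡ ← m≤n⇒∃[o]m+o≡n (<⇒≤ (d<points P! cf np F∈L)) =
      conclude (erdős–gallai _≟ᴮ_ V (Unique-filter⁺ (F ∋?_) P!) 2s≤w (own L F)
        (no-large-coMatching P! cf np F∈L (≤-reflexive (sym w≡))))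
      where
      V = points F P
      w = length V

      w≤2d : w ≤ d + d
      w≤2d = s≤s⁻¹ (*-cancelˡ-< b _ _ (<-≤-trans light (*-monoˡ-≤ (suc (d + d)) a≤b)))

      -- Lightness gives `w ≤ d + d`, so `s` is at most `suc d`.
      2s≤w : 2 * s ≤ w
      2s≤w = begin
        2 * s         ≡⟨ cong (s +_) (+-identityʳ s) ⟩
        s + s         ≤⟨ +-monoˡ-≤ s (+-cancelˡ-≤ (suc d) _ _ (≤-trans (≤-reflexive w≡) (≤-trans w≤2d (+-mono-≤ (n≤1+n d) (n≤1+n d))))) ⟩
        suc d + s     ≡⟨ w≡ ⟩
        w             ∎
        where open ≤-Reasoning

      b*w≤ : b * w ≤ 2 * (a * suc d)
      b*w≤ = ≤-trans (<⇒≤ light) (≤-trans (*-monoʳ-≤ a (≤-trans (n≤1+n _) (≤-reflexive (two-suc d)))) (≤-reflexive (assoc a (suc d))))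
        where
        two-suc : ∀ d → 2 + (d + d) ≡ 2 * suc d
        two-suc = solve-∀
        assoc : ∀ a d → a * (2 * d) ≡ 2 * (a * d)
        assoc = solve-∀

      conclude : (∃₂ λ α γ → α + γ < w × 2 * w ≤ 2 * α + γ + 2 * s ×
                   α * (α + 2 * γ + 1) ≤ Degrees.total V (own L F)) →
                 a * (suc d * suc d) < b * ownPairs L P F
      conclude (α , γ , α+γ<w , 2w≤ , ≤total) =
        <-≤-trans (light-bound α γ (s≤s z≤n) b*w≤ α+γ<w 2d≤)
          (*-monoʳ-≤ b (≤-trans ≤total
            (∑-filter-≤ (F ∋?_) P λ x → ∑-filter-≤ (F ∋?_) P λ y → ≤-refl)))
        where
        2d≤ : 2 * suc d ≤ 2 * α + γ
        2d≤ = +-cancelʳ-≤ (2 * s) _ _ (≤-trans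
          (≤-reflexive (trans (sym (*-distribˡ-+ 2 (suc d) s)) (cong (2 *_) w≡))) 2w≤)

    -- In contrast to `ManyPoints`, equally many members and points are allowed. With a heavy member
    -- the induction applies after its removal; with light members only, the owned pairs are too
    -- many.
    noPrivate-bound : ∀ {d L P} → ManyPoints d → Unique L → Unique P → CoverFree (suc d) L P →
      NoPrivate L P → 1 ≤ length L → length P ≤ length L → a * (suc d * suc d) < b * length P
    noPrivate-bound {d} {L} {P} manyPoints L! P! cf np 1≤L P≤L
      with any? (λ F → a * suc (d + d) ≤? b * length (points F P)) L
    ... | yes found with F , F∈L , heavy ← find found =
      heavy-step {d} {m = length P₁} heavy
        (manyPoints (remove-! _≟ᴬ_ F L!) (Unique-filter⁺ (¬? ∘ (F ∋?_)) P!) cf₁ P₁<L₁)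
        (≤-reflexive P₁+w≡P)
      where
      L₁ = remove _≟ᴬ_ F L
      P₁ = filter (¬? ∘ (F ∋?_)) P

      P₁+w≡P : length P₁ + length (points F P) ≡ length P
      P₁+w≡P = length-filter-∁ (F ∋?_) P

      -- Adding `F` to a cover uses up one of the `suc d` places and forces the witness outside `F`.
      cf₁ : CoverFree d L₁ P₁
      cf₁ {G} Gs G∈L₁ Gs⊆L₁ G∉Gs size
        with G∈L , G≢F ← ∈-remove⁻ _≟ᴬ_ {xs = L} G∈L₁
        with p , p∈P , G∋p , F∌p ∷ ∌p ← cf (F ∷ Gs) G∈L
               (λ { (here refl) → F∈L ; (there H∈) → proj₁ (∈-remove⁻ _≟ᴬ_ {xs = L} (Gs⊆L₁ H∈)) })
               (λ { (here G≡F) → G≢F G≡F ; (there G∈) → G∉Gs G∈ }) (s≤s size) =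
        p , ∈-filter⁺ (¬? ∘ (F ∋?_)) p∈P F∌p , G∋p , ∌p

      -- One member goes but at least two points go with it, which makes the inequality strict.
      P₁<L₁ : length P₁ < length L₁
      P₁<L₁ = s≤s⁻¹ (begin
        2 + length P₁                        ≡⟨ +-comm 2 (length P₁) ⟩
        length P₁ + 2                        ≤⟨ +-monoʳ-≤ (length P₁) (≤-trans (s≤s (s≤s z≤n)) (d<points P! cf np F∈L)) ⟩
        length P₁ + length (points F P)      ≡⟨ P₁+w≡P ⟩
        length P                             ≤⟨ P≤L ⟩
        length L                             ≤⟨ length-remove-≥ _≟ᴬ_ F L! ⟩
        1 + length L₁                        ∎)
        where open ≤-Reasoning
    ... | no none = ≰⇒> λ small → <⇒≱ (overfull small) (∑-ownPairs-≤ P L!)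
      where
      -- If the bound fails, every member owns more than `length P` ordered pairs.
      overfull : b * length P ≤ a * (suc d * suc d) → length P * length P < ∑ L (ownPairs L P)
      overfull small = begin-strict
        length P * length P                  ≤⟨ *-monoˡ-≤ (length P) P≤L ⟩
        length L * length P                  <⟨ *-monoʳ-< (length L) ⦃ >-nonZero 1≤L ⦄ (n<1+n _) ⟩
        length L * suc (length P)            ≡⟨ ∑-const L _ ⟨
        ∑ L (const (suc (length P)))         ≤⟨ ∑-mono L (λ F∈L → *-cancelˡ-< b _ _
                                                  (≤-<-trans small (light-ownPairs P! cf np F∈L (≰⇒> (none ∘ lose F∈L))))) ⟩
        ∑ L (ownPairs L P)                   ∎
        where open ≤-Reasoning

    manyPoints : ∀ d → ManyPoints d
    manyPoints zero {F ∷ L} {P} _ _ cf _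
      with p , p∈P , _ ← cf [] (here refl) (λ ()) (λ ()) z≤n = begin-strict
      a * 0           ≡⟨ *-zeroʳ a ⟩
      0               <⟨ *-mono-≤ 0<b (∈-length p∈P) ⟩
      b * length P    ∎
      where open ≤-Reasoning
    manyPoints (suc d) {L} {P} L! P! cf P<L = by-cases (Core.stuck C)
      where
      C : Core 0 L P
      -- Threshold 0 suffices: the strict surplus of members survives deletion, so the core is
      -- nonempty.
      C = core 0 L! P! z≤n
      open Core C

      P′<L′ : length P′ < length L′
      P′<L′ = +-cancelˡ-≤ (length P) _ _ (begin
        length P + suc (length P′)   ≡⟨ +-suc _ _ ⟩
        suc (length P) + length P′   ≤⟨ +-monoˡ-≤ (length P′) P<L ⟩
        length L + length P′         ≤⟨ balance ⟩
        length P + length L′         ∎)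
        where open ≤-Reasoning

      by-cases : NoPrivate L′ P′ ⊎ length L′ ≤ 0 → a * (suc d * suc d) < b * length P
      by-cases (inj₁ np) = <-≤-trans
        (noPrivate-bound (manyPoints d) L′! P′! (coverFree cf) np (≤-trans (s≤s z≤n) P′<L′) (<⇒≤ P′<L′))
        (*-monoʳ-≤ b P′≤P)
      by-cases (inj₂ L′≤0) = contradiction (≤-trans P′<L′ L′≤0) λ ()

-- From frameproof codes to cover-free families

_≟ʷ_ : ∀ {q n} → DecidableEquality (Word q n)
_≟ʷ_ = ≡-dec Fin._≟_

Differs : ∀ {q n} → Word q n → Word q n → Fin n → Set
Differs c₀ c i = lookup c i ≢ lookup c₀ i

differs? : ∀ {q n} (c₀ c : Word q n) i → Dec (Differs c₀ c i)
differs? c₀ c i = ¬? (lookup c i Fin.≟ lookup c₀ i)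

-- If no such position existed, then at every undetectable position of the coalition `c₀ ∷ Gs`,
-- where all of `Gs` agree with `c₀`, `F` would agree with `c₀` too. The coalition would then
-- produce `F`. The word `c₀` takes one of the `t` places.
differences-coverFree : ∀ {q n t} {C : List (Word q n)} {c₀ F} → WideSenseFrameproof t C → c₀ ∈ C →
  ∀ Gs → F ∈ C → Gs ⊆ C → F ∉ c₀ ∷ Gs → suc (length Gs) ≤ t →
  ∃ λ i → Differs c₀ F i × All (λ G → ¬ Differs c₀ G i) Gs
differences-coverFree {C = C} {c₀} {F} fp c₀∈C Gs F∈C Gs⊆C F∉ size
  with Fin.any? (λ i → differs? c₀ F i ×-dec all? (λ G → ¬? (differs? c₀ G i)) Gs)
... | yes found = found
... | no none = contradiction
  (∈-deduplicate⁻ _≟ʷ_ (c₀ ∷ Gs) (fp coalition (λ ()) (deduplicate-! _≟ʷ_ (c₀ ∷ Gs))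
    (≤-trans (length-deduplicate _≟ʷ_ (c₀ ∷ Gs)) size) (c₀∷Gs⊆C ∘ ∈-deduplicate⁻ _≟ʷ_ (c₀ ∷ Gs)) F F∈C produced)) F∉
  where
  coalition = deduplicate _≟ʷ_ (c₀ ∷ Gs)

  c₀∷Gs⊆C : c₀ ∷ Gs ⊆ C
  c₀∷Gs⊆C (here refl) = c₀∈C
  c₀∷Gs⊆C (there G∈)  = Gs⊆C G∈

  produced : InWdesc F coalition
  produced i undetectable c c∈ = trans
    (decidable-stable (lookup F i Fin.≟ lookup c₀ i) λ differs → none (i , differs ,
      All.tabulate λ {G} G∈ differs′ → differs′ (undetectable G c₀ (∈-deduplicate⁺ _≟ʷ_ (there G∈)) (here refl))))
    (undetectable c₀ c (here refl) c∈)

frameproof-bound : ∀ {q n d} → 2 ≤ n → BelowBound n (suc (suc d)) → (C : List (Word q n)) → Unique C →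
                   WideSenseFrameproof (suc (suc d)) C → ¬ n < length C
frameproof-bound {q} {n} {d} 2≤n below (c₀ ∷ L) (c₀∉L ∷ L!) fp (s≤s n≤L)
  with a , b , 0<b , root , bn≤ad² ← BelowBound⇒constant {n} {suc d} (s≤s z≤n) below = by-cases stuck
  where
  open Family {A = Word q n} _≟ʷ_ Fin._≟_ (Differs c₀) (differs? c₀)
  open Bound a b 0<b root

  ∣allFin∣ : length (allFin n) ≡ n
  ∣allFin∣ = length-tabulate (λ i → i)

  cf : CoverFree (suc d) L (allFin n)
  cf Gs F∈L Gs⊆L F∉Gs size
    with i , F∋i , ∌i ← differences-coverFree fp (here refl) Gs (there F∈L) (there ∘ Gs⊆L)
           (λ { (here F≡c₀) → All.lookup c₀∉L F∈L (sym F≡c₀) ; (there F∈) → F∉Gs F∈ }) (s≤s size) =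
    i , ∈-allFin i , F∋i , ∌i

  C′ : Core 2 L (allFin n)
  -- Setting `c₀` aside leaves only `n ≤ length L`, so deletion could exhaust the family without
  -- contradiction. It stops at two members, where three words compete for at most two positions.
  C′ = core 2 L! (allFin⁺ n) (≤-trans 2≤n n≤L)
  open Core C′

  P′≤L′ : length P′ ≤ length L′
  P′≤L′ = +-cancelˡ-≤ (length L) _ _ (≤-trans balance
    (+-monoˡ-≤ (length L′) (≤-trans (≤-reflexive ∣allFin∣) n≤L)))

  -- With two words x , y left besides c₀, each of the three words differs from the
  -- other two at a position of P′, and these positions are distinct.
  two-left : ∀ L′ → L′ ⊆ L → Unique L′ → CoverFree (suc d) L′ P′ →
             (∀ {F p} → F ∈ L′ → Differs c₀ F p → p ∈ P′) → 2 ≤ length L′ → ¬ length P′ ≤ 2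
  two-left (x ∷ []) _ _ _ _ (s≤s ())
  two-left (x ∷ y ∷ L″) L′⊆L ((x≢y ∷ _) ∷ _) cf′ ⊆P′ _ P′≤2
    with i , i∈P′ , x∋i , y∌i ∷ [] ← cf′ (y ∷ []) (here refl) (λ { (here refl) → there (here refl) })
           (λ { (here x≡y) → x≢y x≡y }) (s≤s z≤n)
    with j , j∈P′ , y∋j , x∌j ∷ [] ← cf′ (x ∷ []) (there (here refl)) (λ { (here refl) → here refl })
           (λ { (here y≡x) → x≢y (sym y≡x) }) (s≤s z≤n)
    -- The reference word is now `x`: at `k` the words `x` and `y` agree and `c₀` differs from both.
    with k , c₀≢x , y≡x ∷ [] ← differences-coverFree fp (there (L′⊆L (here refl))) (y ∷ []) (here refl)
           (λ { (here refl) → there (L′⊆L (there (here refl))) })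
           (λ { (here c₀≡x) → All.lookup c₀∉L (L′⊆L (here refl)) c₀≡x
              ; (there (here c₀≡y)) → All.lookup c₀∉L (L′⊆L (there (here refl))) c₀≡y })
           (s≤s (s≤s z≤n)) =
    <⇒≱ (Unique-⊆⇒length-≤ {xs = i ∷ j ∷ k ∷ []}
      (((λ { refl → y∌i y∋j }) ∷ (λ { refl → y∌i y∋k }) ∷ []) ∷ ((λ { refl → x∌j x∋k }) ∷ []) ∷ [] ∷ [])
      (λ { (here refl) → i∈P′ ; (there (here refl)) → j∈P′ ; (there (there (here refl))) → ⊆P′ (here refl) x∋k }))
      P′≤2
    where
    x∋k : Differs c₀ x k
    x∋k = c₀≢x ∘ sym
    y∋k : Differs c₀ y k
    y∋k y≡c₀ = y≡x λ y≡x → c₀≢x (trans (sym y≡c₀) y≡x)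

  by-cases : NoPrivate L′ P′ ⊎ length L′ ≤ 2 → ⊥
  -- The bound on `P′` contradicts `b * n ≤ a * (suc d * suc d)`, as `P′` has at most `n` points.
  by-cases (inj₁ np) = <⇒≱
    (noPrivate-bound (manyPoints d) L′! P′! (coverFree cf) np (≤-trans (s≤s z≤n) k≤L′) P′≤L′)
    (≤-trans (*-monoʳ-≤ b (≤-trans P′≤P (≤-reflexive ∣allFin∣))) bn≤ad²)
  by-cases (inj₂ L′≤2) = two-left L′ L′⊆L L′! (coverFree cf) (λ F∈ → points⊆P′ F∈ (∈-allFin _)) k≤L′
    (≤-trans P′≤L′ L′≤2)

theorem1p13 : (q t n : ℕ) → 2 ≤ q → 3 ≤ t → 2 ≤ n → BelowBound n t →
    (C : List (Word q n)) → Unique C → WideSenseFrameproof t C → length C ≤ n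
theorem1p13 q (suc (suc d)) n _ (s≤s (s≤s _)) 2≤n below C C! fp = ≮⇒≥ (frameproof-bound 2≤n below C C! fp)
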